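{- In MLTT°, if $\Gamma\vdash M:A$ and $M\rightsquigarrow^* M'$ (head reduction), then $\Gamma\vdash M':A$.
   Context: MLTT° is the following type theory (dependent products and one universe with type-in-type). Terms are $M,N,A,B ::= x \mid \mathcal{U} \mid \Pi_{x:A}B \mid \lambda_{x:A}M \mid M\,N$, up to $\alpha$-equivalence, with capture-avoiding substitution $M[N/x]$. Contexts are finite lists of declarations $x:A$. The judgements $\vdash\Gamma$ (well-formed context), $\Gamma\vdash M:A$ (typing) and $\Gamma\vdash M\equiv N:A$ (definitional equality) are mutually inductively generated by the following rules. Contexts: the empty context is well-formed; if $\vdash\Gamma$ and $\Gamma\vdash A:\mathcal{U}$ then $\vdash\Gamma,x:A$ ($x$ fresh). Typing: (Var) if $\vdash\Gamma$ and $(x:A)\in\Gamma$ then $\Gamma\vdash x:A$. (Univ) if $\vdash\Gamma$ then $\Gamma\vdash\mathcal{U}:\mathcal{U}$. (Pi) if $\Gamma\vdash A:\mathcal{U}$ and $\Gamma,x:A\vdash B:\mathcal{U}$ then $\Gamma\vdash\Pi_{x:A}B:\mathcal{U}$. (Lam) if $\Gamma\vdash A:\mathcal{U}$ and $\Gamma,x:A\vdash M:B$ then $\Gamma\vdash\lambda_{x:A}M:\Pi_{x:A}B$. (App) if $\Gamma\vdash M:\Pi_{x:A}B$ and $\Gamma\vdash N:A$ then $\Gamma\vdash M\,N:B[N/x]$. (Conv) if $\Gamma\vdash M:A$ and $\Gamma\vdash A\equiv B:\mathcal{U}$ then $\Gamma\vdash M:B$. Definitional equality: reflexivity on well-typed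 terms, symmetry, transitivity; conversion (if $\Gamma\vdash M\equiv N:A$ and $\Gamma\vdash A\equiv B:\mathcal{U}$ then $\Gamma\vdash M\equiv N:B$); congruence rules for $\Pi$, $\lambda$ and application; ($\beta$) if $\Gamma\vdash A:\mathcal{U}$, $\Gamma,x:A\vdash M:B$ and $\Gamma\vdash N:A$ then $\Gamma\vdash(\lambda_{x:A}M)\,N\equiv M[N/x]:B[N/x]$; ($\eta$) if $\Gamma\vdash M:\Pi_{x:A}B$, $\Gamma\vdash N:\Pi_{x:A}B$ and $\Gamma,x:A\vdash M\,x\equiv N\,x:B$ ($x$ fresh) then $\Gamma\vdash M\equiv N:\Pi_{x:A}B$. Head reduction: one-step head reduction $M\rightsquigarrow M'$ on (untyped) terms is generated by $(\lambda_{x:A}M)\,N\rightsquigarrow M[N/x]$ and: if $M\rightsquigarrow M'$ then $M\,N\rightsquigarrow M'\,N$. Its reflexive-transitive closure is $\rightsquigarrow^*$. -}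

module Defs where

open import Data.Nat.Base using (ℕ; zero; suc)
open import Data.Fin.Base using (Fin; zero; suc)
open import Data.Fin.Substitution using (Sub; Lift; TermSubst)
open import Data.Vec.Base using (lookup)
open import Relation.Binary.Construct.Closure.ReflexiveTransitive using (Star)

private
  variable
    n : ℕ

infixl 20 _·_
infixl 5  _▷_
infix  4  _⦂_∈_ ⊢_ _⊢_⦂_ _⊢_≐_⦂_ _↝_ _↝*_

-- Terms up to α-equivalence are well-scoped de Bruijn terms: Tm n has free
-- variables in Fin n, and the second argument of Π and of ƛ binds variable zero.
data Tm : ℕ → Set where
  var : Fin n → Tm n
  U   : Tm n
  Π   : Tm n → Tm (suc n) → Tm n
  ƛ   : Tm n → Tm (suc n) → Tm n
  _·_ : Tm n → Tm n → Tm n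

private
  module App {T : ℕ → Set} (l : Lift T Tm) where
    open Lift l using (lift; _↑)

    _/′_ : ∀ {m n} → Tm m → Sub T m n → Tm n
    var x   /′ ρ = lift (lookup ρ x)
    U       /′ ρ = U
    Π A B   /′ ρ = Π (A /′ ρ) (B /′ (ρ ↑))
    ƛ A M   /′ ρ = ƛ (A /′ ρ) (M /′ (ρ ↑))
    (M · N) /′ ρ = (M /′ ρ) · (N /′ ρ)

tmSubst : TermSubst Tm
tmSubst = record { var = var; app = App._/′_ }

open TermSubst tmSubst public using (_/_; _/Var_; weaken; sub)

-- B [ N ] is B[N/x] for x the variable zero of B.
_[_] : Tm (suc n) → Tm n → Tm n
B [ N ] = B / sub N

-- The type of each declaration is scoped over the declarations to its left.
data Ctx : ℕ → Set where
  ∅   : Ctx zero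
  _▷_ : Ctx n → Tm n → Ctx (suc n)

-- (x : A) ∈ Γ, with A weakened from its own prefix to all of Γ.
data _⦂_∈_ : Fin n → Tm n → Ctx n → Set where
  here  : {Γ : Ctx n} {A : Tm n} → zero ⦂ weaken A ∈ Γ ▷ A
  there : {Γ : Ctx n} {A B : Tm n} {x : Fin n} →
          x ⦂ A ∈ Γ → suc x ⦂ weaken A ∈ Γ ▷ B

data ⊢_      : Ctx n → Set
data _⊢_⦂_   : Ctx n → Tm n → Tm n → Set
data _⊢_≐_⦂_ : Ctx n → Tm n → Tm n → Tm n → Set

data ⊢_ where
  empty  : ⊢ ∅
  extend : {Γ : Ctx n} {A : Tm n} →
           ⊢ Γ → Γ ⊢ A ⦂ U → ⊢ Γ ▷ A

data _⊢_⦂_ where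
  ty-var  : {Γ : Ctx n} {x : Fin n} {A : Tm n} →
            ⊢ Γ → x ⦂ A ∈ Γ → Γ ⊢ var x ⦂ A
  ty-univ : {Γ : Ctx n} →
            ⊢ Γ → Γ ⊢ U ⦂ U
  ty-pi   : {Γ : Ctx n} {A : Tm n} {B : Tm (suc n)} →
            Γ ⊢ A ⦂ U → Γ ▷ A ⊢ B ⦂ U → Γ ⊢ Π A B ⦂ U
  ty-lam  : {Γ : Ctx n} {A : Tm n} {M B : Tm (suc n)} →
            Γ ⊢ A ⦂ U → Γ ▷ A ⊢ M ⦂ B → Γ ⊢ ƛ A M ⦂ Π A B
  ty-app  : {Γ : Ctx n} {M N A : Tm n} {B : Tm (suc n)} →
            Γ ⊢ M ⦂ Π A B → Γ ⊢ N ⦂ A → Γ ⊢ M · N ⦂ B [ N ]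
  ty-conv : {Γ : Ctx n} {M A B : Tm n} →
            Γ ⊢ M ⦂ A → Γ ⊢ A ≐ B ⦂ U → Γ ⊢ M ⦂ B

-- The congruence rule for ƛ relates both the domain annotation and the body.
data _⊢_≐_⦂_ where
  eq-refl  : {Γ : Ctx n} {M A : Tm n} →
             Γ ⊢ M ⦂ A → Γ ⊢ M ≐ M ⦂ A
  eq-sym   : {Γ : Ctx n} {M N A : Tm n} →
             Γ ⊢ M ≐ N ⦂ A → Γ ⊢ N ≐ M ⦂ A
  eq-trans : {Γ : Ctx n} {M N P A : Tm n} →
             Γ ⊢ M ≐ N ⦂ A → Γ ⊢ N ≐ P ⦂ A → Γ ⊢ M ≐ P ⦂ A
  eq-conv  : {Γ : Ctx n} {M N A B : Tm n} →
             Γ ⊢ M ≐ N ⦂ A → Γ ⊢ A ≐ B ⦂ U → Γ ⊢ M ≐ N ⦂ B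
  eq-pi    : {Γ : Ctx n} {A A′ : Tm n} {B B′ : Tm (suc n)} →
             Γ ⊢ A ≐ A′ ⦂ U → Γ ▷ A ⊢ B ≐ B′ ⦂ U →
             Γ ⊢ Π A B ≐ Π A′ B′ ⦂ U
  eq-lam   : {Γ : Ctx n} {A A′ : Tm n} {M M′ B : Tm (suc n)} →
             Γ ⊢ A ≐ A′ ⦂ U → Γ ▷ A ⊢ M ≐ M′ ⦂ B →
             Γ ⊢ ƛ A M ≐ ƛ A′ M′ ⦂ Π A B
  eq-app   : {Γ : Ctx n} {M M′ N N′ A : Tm n} {B : Tm (suc n)} →
             Γ ⊢ M ≐ M′ ⦂ Π A B → Γ ⊢ N ≐ N′ ⦂ A →
             Γ ⊢ M · N ≐ M′ · N′ ⦂ B [ N ]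
  eq-β     : {Γ : Ctx n} {N A : Tm n} {M B : Tm (suc n)} →
             Γ ⊢ A ⦂ U → Γ ▷ A ⊢ M ⦂ B → Γ ⊢ N ⦂ A →
             Γ ⊢ ƛ A M · N ≐ M [ N ] ⦂ B [ N ]
  eq-η     : {Γ : Ctx n} {M N A : Tm n} {B : Tm (suc n)} →
             Γ ⊢ M ⦂ Π A B → Γ ⊢ N ⦂ Π A B →
             Γ ▷ A ⊢ weaken M · var zero ≐ weaken N · var zero ⦂ B →
             Γ ⊢ M ≐ N ⦂ Π A B

data _↝_ : Tm n → Tm n → Set where
  β    : {A N : Tm n} {M : Tm (suc n)} → ƛ A M · N ↝ M [ N ]
  appˡ : {M M′ N : Tm n} → M ↝ M′ → M · N ↝ M′ · N

_↝*_ : Tm n → Tm n → Set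
_↝*_ = Star _↝_

{-# OPTIONS --safe #-}

-- Preservation under β reduces, by inversion, to injectivity of Π for definitional
-- equality.  Type-in-type rules out normalization, so injectivity is obtained from
-- a domain-theoretic model in the style of Coquand and Huber.  The denotation ⟦ M ⟧ ρ
-- of a term is the set of its approximations by well-founded atoms, and convertible
-- terms have equal denotations.  A binary logical relation between terms is defined
-- by recursion on atoms rather than on types, so U ⦂ U causes no circularity.  Every term is related to any term convertible
-- to it at the atoms of its denotation.  Since Π A B always denotes the atom recording
-- only that its head is Π, and being related at that atom includes typed equality of
-- the domains and of the codomains, Π is injective.

module Submission where

open import Defs
open import Data.Nat.Base using (ℕ; zero; suc)
open import Data.Fin.Base using (Fin; zero; suc)
open import Data.Fin.Substitution using (Sub; Subs; Lift; TermSubst; module VarSubst)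
open import Data.Fin.Substitution.Lemmas using (TermLemmas; module VarLemmas)
open import Data.Vec.Base using (_∷_; lookup; map)
open import Data.Vec.Properties using (lookup-map)
open import Data.Product.Base using (Σ; Σ-syntax; ∃; _×_; _,_; proj₁; proj₂)
open import Data.Sum.Base using (inj₁; inj₂; [_,_]′)
open import Data.Unit.Base using (⊤; tt)
open import Data.Empty using (⊥)
open import Function.Base using (case_of_)
import Level
open import Relation.Binary.PropositionalEquality
  using (_≡_; refl; sym; trans; cong; cong₂; subst; subst₂)
open import Relation.Binary.Construct.Closure.ReflexiveTransitive using (ε; _◅_; _◅◅_)

private
  variable
    m n : ℕ

-- Laws of simultaneous substitution

module _ {T : ℕ → Set} (l : Lift T Tm) where
  open TermSubst.Lifted tmSubst l using (_↑✶_; _/✶_)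

  Π-/✶-↑✶ : ∀ k {A B} (ρs : Subs T m n) →
            Π A B /✶ ρs ↑✶ k ≡ Π (A /✶ ρs ↑✶ k) (B /✶ ρs ↑✶ suc k)
  Π-/✶-↑✶ k ε        = refl
  Π-/✶-↑✶ k (ρ ◅ ρs) = cong (λ M → TermSubst.app tmSubst l M _) (Π-/✶-↑✶ k ρs)

  ƛ-/✶-↑✶ : ∀ k {A M} (ρs : Subs T m n) →
            ƛ A M /✶ ρs ↑✶ k ≡ ƛ (A /✶ ρs ↑✶ k) (M /✶ ρs ↑✶ suc k)
  ƛ-/✶-↑✶ k ε        = refl
  ƛ-/✶-↑✶ k (ρ ◅ ρs) = cong (λ M → TermSubst.app tmSubst l M _) (ƛ-/✶-↑✶ k ρs)

  ·-/✶-↑✶ : ∀ k {M N} (ρs : Subs T m n) →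
            (M · N) /✶ ρs ↑✶ k ≡ (M /✶ ρs ↑✶ k) · (N /✶ ρs ↑✶ k)
  ·-/✶-↑✶ k ε        = refl
  ·-/✶-↑✶ k (ρ ◅ ρs) = cong (λ M → TermSubst.app tmSubst l M _) (·-/✶-↑✶ k ρs)

  U-/✶-↑✶ : ∀ k (ρs : Subs T m n) → U /✶ ρs ↑✶ k ≡ U
  U-/✶-↑✶ k ε        = refl
  U-/✶-↑✶ k (ρ ◅ ρs) = cong (λ M → TermSubst.app tmSubst l M _) (U-/✶-↑✶ k ρs)

-- The generic laws reduce to one fact: two sequences of substitutions that agree on variables under
-- any number of binders agree on all terms. The lemmas above push such a sequence through each
-- constructor.
tmLemmas : TermLemmas Tm
tmLemmas = record
  { termSubst = tmSubst
  ; app-var   = refl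
  ; /✶-↑✶     = /✶-↑✶
  }
  where
  module _ {T₁ T₂ : ℕ → Set} {l₁ : Lift T₁ Tm} {l₂ : Lift T₂ Tm} where
    open TermSubst.Lifted tmSubst l₁ using () renaming (_↑✶_ to _↑✶₁_; _/✶_ to _/✶₁_)
    open TermSubst.Lifted tmSubst l₂ using () renaming (_↑✶_ to _↑✶₂_; _/✶_ to _/✶₂_)

    /✶-↑✶ : (ρs₁ : Subs T₁ m n) (ρs₂ : Subs T₂ m n) →
            (∀ k x → var x /✶₁ ρs₁ ↑✶₁ k ≡ var x /✶₂ ρs₂ ↑✶₂ k) →
            ∀ k M → M /✶₁ ρs₁ ↑✶₁ k ≡ M /✶₂ ρs₂ ↑✶₂ k
    /✶-↑✶ ρs₁ ρs₂ hyp k (var x) = hyp k x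
    /✶-↑✶ ρs₁ ρs₂ hyp k U
      rewrite U-/✶-↑✶ l₁ k ρs₁ | U-/✶-↑✶ l₂ k ρs₂ = refl
    /✶-↑✶ ρs₁ ρs₂ hyp k (Π A B)
      rewrite Π-/✶-↑✶ l₁ k {A} {B} ρs₁ | Π-/✶-↑✶ l₂ k {A} {B} ρs₂ =
      cong₂ Π (/✶-↑✶ ρs₁ ρs₂ hyp k A) (/✶-↑✶ ρs₁ ρs₂ hyp (suc k) B)
    /✶-↑✶ ρs₁ ρs₂ hyp k (ƛ A M)
      rewrite ƛ-/✶-↑✶ l₁ k {A} {M} ρs₁ | ƛ-/✶-↑✶ l₂ k {A} {M} ρs₂ =
      cong₂ ƛ (/✶-↑✶ ρs₁ ρs₂ hyp k A) (/✶-↑✶ ρs₁ ρs₂ hyp (suc k) M)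
    /✶-↑✶ ρs₁ ρs₂ hyp k (M · N)
      rewrite ·-/✶-↑✶ l₁ k {M} {N} ρs₁ | ·-/✶-↑✶ l₂ k {M} {N} ρs₂ =
      cong₂ _·_ (/✶-↑✶ ρs₁ ρs₂ hyp k M) (/✶-↑✶ ρs₁ ρs₂ hyp k N)

open TermLemmas tmLemmas using
  ( _↑; id; wk; lookup-id; lookup-wk; id-vanishes; /-⊙; /-wk; sub-commutes
  ; weaken-∷; weaken-↑; weaken-var; map-weaken-⊙-sub)

-- Admissibility of substitution and presuppositions

infix 4 _⊢_≗_⦂_

/wk≡weaken : (M : Tm n) → M / wk ≡ weaken M
/wk≡weaken M = /-wk {t = M}

cast-∈ : {Γ : Ctx n} {x : Fin n} {A B : Tm n} → A ≡ B → x ⦂ A ∈ Γ → x ⦂ B ∈ Γ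
cast-∈ refl x∈ = x∈

cast-ty : {Γ : Ctx n} {M N A B : Tm n} → M ≡ N → A ≡ B → Γ ⊢ M ⦂ A → Γ ⊢ N ⦂ B
cast-ty refl refl d = d

cast-eq : {Γ : Ctx n} {M M′ N N′ A B : Tm n} → M ≡ M′ → N ≡ N′ → A ≡ B →
          Γ ⊢ M ≐ N ⦂ A → Γ ⊢ M′ ≐ N′ ⦂ B
cast-eq refl refl refl d = d

-- One induction serves two instances. Lifting a typed substitution needs weakening, which is itself
-- stability under a renaming, so the induction is run for renamings first.
module Stability
  (Admits : ∀ {m n} → Ctx n → Sub Tm m n → Ctx m → Set)
  (lookup-ty : ∀ {m n} {Δ : Ctx n} {σ} {Γ : Ctx m} {x A} → ⊢ Δ → Admits Δ σ Γ →
               x ⦂ A ∈ Γ → Δ ⊢ lookup σ x ⦂ A / σ)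
  (lift : ∀ {m n} {Δ : Ctx n} {σ} {Γ : Ctx m} {A} → Δ ⊢ A / σ ⦂ U → ⊢ Δ → Admits Δ σ Γ →
          Admits (Δ ▷ A / σ) (σ ↑) (Γ ▷ A))
  where

  -- Lifting a substitution under a binder of type A needs A to be a type, which
  -- eq-pi and eq-lam provide only through the context of their second premise;
  -- carrying stability of the last declaration keeps the recursion structural.
  StableLast : Ctx m → Set
  StableLast ∅       = ⊤
  StableLast (Γ ▷ A) = ∀ {n} {Δ : Ctx n} {σ} → ⊢ Δ → Admits Δ σ Γ → Δ ⊢ A / σ ⦂ U

  stable-ctx : {Γ : Ctx m} → ⊢ Γ → StableLast Γ
  stable-ty  : {Γ : Ctx m} {M A : Tm m} → Γ ⊢ M ⦂ A →
    StableLast Γ × (∀ {n} {Δ : Ctx n} {σ} → ⊢ Δ → Admits Δ σ Γ → Δ ⊢ M / σ ⦂ A / σ)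
  stable-eq  : {Γ : Ctx m} {M N A : Tm m} → Γ ⊢ M ≐ N ⦂ A →
    StableLast Γ × (∀ {n} {Δ : Ctx n} {σ} → ⊢ Δ → Admits Δ σ Γ → Δ ⊢ M / σ ≐ N / σ ⦂ A / σ)

  stable-ctx empty        = tt
  stable-ctx (extend _ A) = proj₂ (stable-ty A)

  stable-ty (ty-var Γ x) = stable-ctx Γ , λ Δ s → lookup-ty Δ s x
  stable-ty (ty-univ Γ)  = stable-ctx Γ , λ Δ s → ty-univ Δ
  stable-ty (ty-pi A B) with stable-ty A | stable-ty B
  ... | Γ , a | _ , b = Γ , λ Δ s →
    ty-pi (a Δ s) (b (extend Δ (a Δ s)) (lift (a Δ s) Δ s))
  stable-ty (ty-lam A M) with stable-ty A | stable-ty M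
  ... | Γ , a | _ , b = Γ , λ Δ s →
    ty-lam (a Δ s) (b (extend Δ (a Δ s)) (lift (a Δ s) Δ s))
  stable-ty (ty-app {Γ = Γ₀} {M} {N} {A} {B} d e) with stable-ty d | stable-ty e
  ... | Γ , a | _ , b = Γ , λ Δ s →
    cast-ty refl (sym (sub-commutes B)) (ty-app (a Δ s) (b Δ s))
  stable-ty (ty-conv d e) with stable-ty d | stable-eq e
  ... | Γ , a | _ , b = Γ , λ Δ s → ty-conv (a Δ s) (b Δ s)

  stable-eq (eq-refl d) with stable-ty d
  ... | Γ , a = Γ , λ Δ s → eq-refl (a Δ s)
  stable-eq (eq-sym d) with stable-eq d
  ... | Γ , a = Γ , λ Δ s → eq-sym (a Δ s)
  stable-eq (eq-trans d e) with stable-eq d | stable-eq e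
  ... | Γ , a | _ , b = Γ , λ Δ s → eq-trans (a Δ s) (b Δ s)
  stable-eq (eq-conv d e) with stable-eq d | stable-eq e
  ... | Γ , a | _ , b = Γ , λ Δ s → eq-conv (a Δ s) (b Δ s)
  stable-eq (eq-pi d e) with stable-eq d | stable-eq e
  ... | Γ , a | A , b = Γ , λ Δ s →
    eq-pi (a Δ s) (b (extend Δ (A Δ s)) (lift (A Δ s) Δ s))
  stable-eq (eq-lam d e) with stable-eq d | stable-eq e
  ... | Γ , a | A , b = Γ , λ Δ s →
    eq-lam (a Δ s) (b (extend Δ (A Δ s)) (lift (A Δ s) Δ s))
  stable-eq (eq-app {B = B} d e) with stable-eq d | stable-eq e
  ... | Γ , a | _ , b = Γ , λ Δ s →
    cast-eq refl refl (sym (sub-commutes B)) (eq-app (a Δ s) (b Δ s))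
  stable-eq (eq-β {M = M} {B} d e f) with stable-ty d | stable-ty e | stable-ty f
  ... | Γ , a | _ , b | _ , c = Γ , λ Δ s →
    cast-eq refl (sym (sub-commutes M)) (sym (sub-commutes B))
      (eq-β (a Δ s) (b (extend Δ (a Δ s)) (lift (a Δ s) Δ s)) (c Δ s))
  stable-eq (eq-η {M = M} {N} {A} {B} d e f) with stable-ty d | stable-ty e | stable-eq f
  ... | Γ , a | _ , b | A′ , c = Γ , λ Δ s →
    eq-η (a Δ s) (b Δ s)
      (cast-eq (cong (_· var zero) (weaken-↑ M)) (cong (_· var zero) (weaken-↑ N)) refl
        (c (extend Δ (A′ Δ s)) (lift (A′ Δ s) Δ s)))

-- Renamings are encoded as term substitutions whose values are variables, so that the laws of `_/_`
-- apply to them directly.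
Renaming : Ctx n → Sub Tm m n → Ctx m → Set
Renaming Δ σ Γ = ∀ {x A} → x ⦂ A ∈ Γ → ∃ λ y → lookup σ x ≡ var y × y ⦂ A / σ ∈ Δ

lookup-Renaming : {Δ : Ctx n} {σ : Sub Tm m n} {Γ : Ctx m} {x : Fin m} {A : Tm m} →
                  ⊢ Δ → Renaming Δ σ Γ → x ⦂ A ∈ Γ → Δ ⊢ lookup σ x ⦂ A / σ
lookup-Renaming Δ s x with s x
... | y , eq , y∈ = cast-ty (sym eq) refl (ty-var Δ y∈)

lift-Renaming : {Δ : Ctx n} {σ : Sub Tm m n} {Γ : Ctx m} {A : Tm m} →
                Δ ⊢ A / σ ⦂ U → ⊢ Δ → Renaming Δ σ Γ → Renaming (Δ ▷ A / σ) (σ ↑) (Γ ▷ A)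
lift-Renaming _ _ s (here {A = A}) =
  zero , refl , cast-∈ (sym (weaken-↑ A)) here
lift-Renaming {σ = σ} _ _ s (there {A = A} {x = x} x∈) with s x∈
... | y , eq , y∈ = suc y ,
  trans (lookup-map x weaken σ) (trans (cong weaken eq) weaken-var) ,
  cast-∈ (sym (weaken-↑ A)) (there y∈)

module Ren = Stability Renaming lookup-Renaming lift-Renaming

wk-Renaming : {Γ : Ctx n} {B : Tm n} → Renaming (Γ ▷ B) wk Γ
wk-Renaming {x = x} {A} x∈ =
  suc x , lookup-wk x , cast-∈ (sym (/wk≡weaken A)) (there x∈)

weaken-ty : {Γ : Ctx n} {M A B : Tm n} → ⊢ Γ ▷ B → Γ ⊢ M ⦂ A → Γ ▷ B ⊢ weaken M ⦂ weaken A
weaken-ty {M = M} {A} Γ d =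
  cast-ty (/wk≡weaken M) (/wk≡weaken A) (proj₂ (Ren.stable-ty d) Γ wk-Renaming)

weaken-eq : {Γ : Ctx n} {M N A B : Tm n} → ⊢ Γ ▷ B → Γ ⊢ M ≐ N ⦂ A →
            Γ ▷ B ⊢ weaken M ≐ weaken N ⦂ weaken A
weaken-eq {M = M} {N} {A} Γ d =
  cast-eq (/wk≡weaken M) (/wk≡weaken N) (/wk≡weaken A)
    (proj₂ (Ren.stable-eq d) Γ wk-Renaming)

Typed : Ctx n → Sub Tm m n → Ctx m → Set
Typed Δ σ Γ = ∀ {x A} → x ⦂ A ∈ Γ → Δ ⊢ lookup σ x ⦂ A / σ

lift-Typed : {Δ : Ctx n} {σ : Sub Tm m n} {Γ : Ctx m} {A : Tm m} →
             Δ ⊢ A / σ ⦂ U → ⊢ Δ → Typed Δ σ Γ → Typed (Δ ▷ A / σ) (σ ↑) (Γ ▷ A)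
lift-Typed A Δ s (here {A = A′}) =
  cast-ty refl (sym (weaken-↑ A′)) (ty-var (extend Δ A) here)
lift-Typed {σ = σ} A Δ s (there {A = A′} {x = x} x∈) =
  cast-ty (sym (lookup-map x weaken σ)) (sym (weaken-↑ A′))
    (weaken-ty (extend Δ A) (s x∈))

module Sbt = Stability Typed (λ _ s → s) lift-Typed

subst-ty : {Δ : Ctx n} {σ : Sub Tm m n} {Γ : Ctx m} {M A : Tm m} →
           ⊢ Δ → Typed Δ σ Γ → Γ ⊢ M ⦂ A → Δ ⊢ M / σ ⦂ A / σ
subst-ty Δ s d = proj₂ (Sbt.stable-ty d) Δ s

subst-eq : {Δ : Ctx n} {σ : Sub Tm m n} {Γ : Ctx m} {M N A : Tm m} →
           ⊢ Δ → Typed Δ σ Γ → Γ ⊢ M ≐ N ⦂ A → Δ ⊢ M / σ ≐ N / σ ⦂ A / σ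
subst-eq Δ s d = proj₂ (Sbt.stable-eq d) Δ s

id-Typed : {Γ : Ctx n} → ⊢ Γ → Typed Γ id Γ
id-Typed Γ {x} {A} x∈ =
  cast-ty (sym (lookup-id x)) (sym (id-vanishes A)) (ty-var Γ x∈)

∷-Typed : {Δ : Ctx n} {σ : Sub Tm m n} {Γ : Ctx m} {A : Tm m} {N : Tm n} →
          Typed Δ σ Γ → Δ ⊢ N ⦂ A / σ → Typed Δ (N ∷ σ) (Γ ▷ A)
∷-Typed s d (here {A = A})     = cast-ty refl (sym (weaken-∷ A)) d
∷-Typed s d (there {A = A} x∈) = cast-ty refl (sym (weaken-∷ A)) (s x∈)

_⊢_≗_⦂_ : Ctx n → Sub Tm m n → Sub Tm m n → Ctx m → Set
Δ ⊢ σ ≗ τ ⦂ Γ = ∀ {x A} → x ⦂ A ∈ Γ → Δ ⊢ lookup σ x ≐ lookup τ x ⦂ A / σ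

≗-lift : {Δ : Ctx n} {σ τ : Sub Tm m n} {Γ : Ctx m} {A : Tm m} →
         Δ ⊢ A / σ ⦂ U → ⊢ Δ → Δ ⊢ σ ≗ τ ⦂ Γ → Δ ▷ A / σ ⊢ σ ↑ ≗ τ ↑ ⦂ Γ ▷ A
≗-lift A Δ s (here {A = A′}) =
  cast-eq refl refl (sym (weaken-↑ A′)) (eq-refl (ty-var (extend Δ A) here))
≗-lift {σ = σ} {τ} A Δ s (there {A = A′} {x = x} x∈) =
  cast-eq (sym (lookup-map x weaken σ)) (sym (lookup-map x weaken τ)) (sym (weaken-↑ A′))
    (weaken-eq (extend Δ A) (s x∈))

≗-∷ : {Δ : Ctx n} {σ τ : Sub Tm m n} {Γ : Ctx m} {A : Tm m} {N N′ : Tm n} →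
      Δ ⊢ σ ≗ τ ⦂ Γ → Δ ⊢ N ≐ N′ ⦂ A / σ → Δ ⊢ N ∷ σ ≗ N′ ∷ τ ⦂ Γ ▷ A
≗-∷ s d (here {A = A})     = cast-eq refl refl (sym (weaken-∷ A)) d
≗-∷ s d (there {A = A} x∈) = cast-eq refl refl (sym (weaken-∷ A)) (s x∈)

-- Proved before the presuppositions because `eq-right` depends on it: the type in `eq-app` is
-- instantiated at `N`, while the right side is naturally typed at `N′`.
functional : {Δ : Ctx n} {σ τ : Sub Tm m n} {Γ : Ctx m} {M A : Tm m} →
             ⊢ Δ → Typed Δ σ Γ → Δ ⊢ σ ≗ τ ⦂ Γ → Γ ⊢ M ⦂ A → Δ ⊢ M / σ ≐ M / τ ⦂ A / σ
functional Δ s e (ty-var _ x∈) = e x∈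
functional Δ s e (ty-univ _)   = eq-refl (ty-univ Δ)
functional Δ s e (ty-pi A B)   =
  let a = subst-ty Δ s A in
  eq-pi (functional Δ s e A)
    (functional (extend Δ a) (lift-Typed a Δ s) (≗-lift a Δ e) B)
functional Δ s e (ty-lam A M)  =
  let a = subst-ty Δ s A in
  eq-lam (functional Δ s e A)
    (functional (extend Δ a) (lift-Typed a Δ s) (≗-lift a Δ e) M)
functional Δ s e (ty-app {B = B} M N) =
  cast-eq refl refl (sym (sub-commutes B))
    (eq-app (functional Δ s e M) (functional Δ s e N))
functional Δ s e (ty-conv M A) = eq-conv (functional Δ s e M) (subst-eq Δ s A)

ty-ctx : {Γ : Ctx n} {M A : Tm n} → Γ ⊢ M ⦂ A → ⊢ Γ
ty-ctx (ty-var Γ _)  = Γ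
ty-ctx (ty-univ Γ)   = Γ
ty-ctx (ty-pi A _)   = ty-ctx A
ty-ctx (ty-lam A _)  = ty-ctx A
ty-ctx (ty-app M _)  = ty-ctx M
ty-ctx (ty-conv M _) = ty-ctx M

sub-Typed : {Γ : Ctx n} {N A : Tm n} → Γ ⊢ N ⦂ A → Typed Γ (sub N) (Γ ▷ A)
sub-Typed {A = A} N =
  ∷-Typed (id-Typed (ty-ctx N)) (cast-ty refl (sym (id-vanishes A)) N)

[]-ty : {Γ : Ctx n} {N A : Tm n} {M B : Tm (suc n)} →
        Γ ▷ A ⊢ M ⦂ B → Γ ⊢ N ⦂ A → Γ ⊢ M [ N ] ⦂ B [ N ]
[]-ty M N = subst-ty (ty-ctx N) (sub-Typed N) M

[]-eq : {Γ : Ctx n} {N A : Tm n} {M M′ B : Tm (suc n)} →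
        Γ ▷ A ⊢ M ≐ M′ ⦂ B → Γ ⊢ N ⦂ A → Γ ⊢ M [ N ] ≐ M′ [ N ] ⦂ B [ N ]
[]-eq M N = subst-eq (ty-ctx N) (sub-Typed N) M

[]-cong : {Γ : Ctx n} {N N′ A : Tm n} {M B : Tm (suc n)} →
          Γ ▷ A ⊢ M ⦂ B → Γ ⊢ N ⦂ A → Γ ⊢ N ≐ N′ ⦂ A → Γ ⊢ M [ N ] ≐ M [ N′ ] ⦂ B [ N ]
[]-cong {A = A} M N e =
  functional (ty-ctx N) (sub-Typed N)
    (≗-∷ (λ x∈ → eq-refl (id-Typed (ty-ctx N) x∈))
         (cast-eq refl refl (sym (id-vanishes A)) e))
    M

-- Replacing the last declaration by an equal type is substitution along the identity, whose value
-- there is typed by conversion.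
▷-conv-Typed : {Γ : Ctx n} {A A′ : Tm n} → Γ ⊢ A′ ⦂ U → Γ ⊢ A′ ≐ A ⦂ U →
               Typed (Γ ▷ A′) id (Γ ▷ A)
▷-conv-Typed {A = A} A′ e (here) =
  cast-ty refl (sym (id-vanishes (weaken A)))
    (ty-conv (ty-var Γ here) (weaken-eq Γ e))
  where Γ = extend (ty-ctx A′) A′
▷-conv-Typed A′ e (there {A = B} x∈) =
  id-Typed (extend (ty-ctx A′) A′) (there x∈)

▷-conv-ty : {Γ : Ctx n} {A A′ : Tm n} {M B : Tm (suc n)} →
            Γ ⊢ A′ ⦂ U → Γ ⊢ A′ ≐ A ⦂ U → Γ ▷ A ⊢ M ⦂ B → Γ ▷ A′ ⊢ M ⦂ B
▷-conv-ty {M = M} {B} A′ e d =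
  cast-ty (id-vanishes M) (id-vanishes B)
    (subst-ty (extend (ty-ctx A′) A′) (▷-conv-Typed A′ e) d)

▷-conv-eq : {Γ : Ctx n} {A A′ : Tm n} {M N B : Tm (suc n)} →
            Γ ⊢ A′ ⦂ U → Γ ⊢ A′ ≐ A ⦂ U → Γ ▷ A ⊢ M ≐ N ⦂ B → Γ ▷ A′ ⊢ M ≐ N ⦂ B
▷-conv-eq {M = M} {N} {B} A′ e d =
  cast-eq (id-vanishes M) (id-vanishes N) (id-vanishes B)
    (subst-eq (extend (ty-ctx A′) A′) (▷-conv-Typed A′ e) d)

Π-inversion : {Γ : Ctx n} {A C : Tm n} {B : Tm (suc n)} →
              Γ ⊢ Π A B ⦂ C → Γ ⊢ A ⦂ U × Γ ▷ A ⊢ B ⦂ U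
Π-inversion (ty-pi A B)   = A , B
Π-inversion (ty-conv d _) = Π-inversion d

∈-valid : {Γ : Ctx n} {x : Fin n} {A : Tm n} → ⊢ Γ → x ⦂ A ∈ Γ → Γ ⊢ A ⦂ U
∈-valid (extend Γ B) here       = weaken-ty (extend Γ B) B
∈-valid (extend Γ B) (there x∈) = weaken-ty (extend Γ B) (∈-valid Γ x∈)

ty-valid : {Γ : Ctx n} {M A : Tm n} → Γ ⊢ M ⦂ A → Γ ⊢ A ⦂ U
eq-left  : {Γ : Ctx n} {M N A : Tm n} → Γ ⊢ M ≐ N ⦂ A → Γ ⊢ M ⦂ A
eq-right : {Γ : Ctx n} {M N A : Tm n} → Γ ⊢ M ≐ N ⦂ A → Γ ⊢ N ⦂ A
eq-valid : {Γ : Ctx n} {M N A : Tm n} → Γ ⊢ M ≐ N ⦂ A → Γ ⊢ A ⦂ U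

ty-valid (ty-var Γ x∈) = ∈-valid Γ x∈
ty-valid (ty-univ Γ)   = ty-univ Γ
ty-valid (ty-pi A B)   = ty-valid A
ty-valid (ty-lam A M)  = ty-pi A (ty-valid M)
ty-valid (ty-app M N)  = []-ty (proj₂ (Π-inversion (ty-valid M))) N
ty-valid (ty-conv M A) = eq-right A

eq-left (eq-refl M)    = M
eq-left (eq-sym e)     = eq-right e
eq-left (eq-trans e f) = eq-left e
eq-left (eq-conv e A)  = ty-conv (eq-left e) A
eq-left (eq-pi A B)    = ty-pi (eq-left A) (eq-left B)
eq-left (eq-lam A M)   = ty-lam (eq-left A) (eq-left M)
eq-left (eq-app M N)   = ty-app (eq-left M) (eq-left N)
eq-left (eq-β A M N)   = ty-app (ty-lam A M) N
eq-left (eq-η M N e)   = M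

eq-right (eq-refl M)    = M
eq-right (eq-sym e)     = eq-left e
eq-right (eq-trans e f) = eq-right f
eq-right (eq-conv e A)  = ty-conv (eq-right e) A
eq-right (eq-pi A B)    =
  ty-pi (eq-right A) (▷-conv-ty (eq-right A) (eq-sym A) (eq-right B))
eq-right (eq-lam A M)   =
  -- The right-hand abstraction is typed over its own domain, and the resulting `Π` type is
  -- converted back to the left-hand domain.
  let M′ = eq-right M ; A′ = eq-right A in
  ty-conv (ty-lam A′ (▷-conv-ty A′ (eq-sym A) M′))
    (eq-pi (eq-sym A) (eq-refl (▷-conv-ty A′ (eq-sym A) (eq-valid M))))
eq-right (eq-app M N)   =
  let B = proj₂ (Π-inversion (eq-valid M)) in
  ty-conv (ty-app (eq-right M) (eq-right N))
    ([]-cong B (eq-right N) (eq-sym N))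
eq-right (eq-β A M N)   = []-ty M N
eq-right (eq-η M N e)   = N

eq-valid (eq-refl M)    = ty-valid M
eq-valid (eq-sym e)     = eq-valid e
eq-valid (eq-trans e f) = eq-valid e
eq-valid (eq-conv e A)  = eq-right A
eq-valid (eq-pi A B)    = eq-valid A
eq-valid (eq-lam A M)   = ty-pi (eq-left A) (eq-valid M)
eq-valid (eq-app M N)   = []-ty (proj₂ (Π-inversion (eq-valid M))) (eq-left N)
eq-valid (eq-β A M N)   = []-ty (ty-valid M) N
eq-valid (eq-η M N e)   = ty-valid M

eq-functional : {Δ : Ctx n} {σ τ : Sub Tm m n} {Γ : Ctx m} {M N A : Tm m} →
                ⊢ Δ → Typed Δ σ Γ → Δ ⊢ σ ≗ τ ⦂ Γ → Γ ⊢ M ≐ N ⦂ A → Δ ⊢ M / σ ≐ N / τ ⦂ A / σ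
eq-functional Δ s e d = eq-trans (subst-eq Δ s d) (functional Δ s e (eq-right d))

-- Denotations

infix 4 _⊑_ _⊑*_

-- univ says that the head is U; w ↦ v that an argument having all of w yields v;
-- pi w v that the head is Π, that the domain has elements with atoms w i (it denotes
-- typeOf (w i)), and likewise the codomain with v j over an argument having all of w.
-- Index sets may be infinite: atoms only have to be well-founded.
data Atom : Set₁ where
  univ : Atom
  pi   : {I J : Set} → (I → Atom) → (J → Atom) → Atom
  _↦_  : {I : Set} → (I → Atom) → Atom → Atom

-- An element with atom `u` belongs to types denoting `typeOf u`. Types are elements of `U`, so both
-- type atoms go to `univ`.
typeOf : Atom → Atom
typeOf univ     = univ
typeOf (pi _ _) = univ
typeOf (w ↦ v)  = pi w (λ (_ : ⊤) → v)

-- A step is smaller when it demands more of its argument and yields less. Only steps are compared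
-- nontrivially, and `typeOf` is not monotone.
data _⊑_ : Atom → Atom → Set₁

_⊑*_ : {I J : Set} → (I → Atom) → (J → Atom) → Set₁
w ⊑* w′ = ∀ i → ∃ λ j → w i ⊑ w′ j

data _⊑_ where
  univ : univ ⊑ univ
  pi   : {I J : Set} {w : I → Atom} {v : J → Atom} → pi w v ⊑ pi w v
  _↦_  : {I J : Set} {w : I → Atom} {w′ : J → Atom} {v v′ : Atom} →
         w′ ⊑* w → v ⊑ v′ → w ↦ v ⊑ w′ ↦ v′

⊑-refl : ∀ u → u ⊑ u
⊑-refl univ     = univ
⊑-refl (pi w v) = pi
⊑-refl (w ↦ v)  = (λ i → i , ⊑-refl (w i)) ↦ ⊑-refl v

⊑-trans : ∀ {u v w} → u ⊑ v → v ⊑ w → u ⊑ w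
⊑-trans univ     univ     = univ
⊑-trans pi       pi       = pi
⊑-trans (f ↦ p) (g ↦ q) =
  (λ i → let j , r = g i ; k , s = f j in k , ⊑-trans r s) ↦ ⊑-trans p q

Family : Set₁
Family = Σ[ I ∈ Set ] (I → Atom)

Env : ℕ → Set₁
Env n = Fin n → Family

infixl 5 _▸_

_▸_ : Env n → Family → Env (suc n)
(ρ ▸ w) zero    = w
(ρ ▸ w) (suc x) = ρ x

_≼_ : Env n → Env n → Set₁
ρ ≼ ρ′ = ∀ x → proj₂ (ρ x) ⊑* proj₂ (ρ′ x)

-- In the clause for ƛ the bound variable denotes w₀, which is typed by A but lies
-- below the possibly ill-typed argument w.
⟦_⟧ : Tm n → Env n → Atom → Set₁
⟦ var x ⟧ ρ u = ∃ λ i → u ⊑ proj₂ (ρ x) i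
⟦ U ⟧ ρ u = u ≡ univ
⟦ Π A B ⟧ ρ (pi w v) =
  (∀ i → ⟦ A ⟧ ρ (typeOf (w i))) × (∀ j → ⟦ B ⟧ (ρ ▸ (_ , w)) (typeOf (v j)))
⟦ Π A B ⟧ ρ _ = Level.Lift _ ⊥
⟦ ƛ A M ⟧ ρ (w ↦ v) = Σ[ w₀ ∈ Family ]
  proj₂ w₀ ⊑* w × (∀ i → ⟦ A ⟧ ρ (typeOf (proj₂ w₀ i))) × ⟦ M ⟧ (ρ ▸ w₀) v
⟦ ƛ A M ⟧ ρ _ = Level.Lift _ ⊥
⟦ M · N ⟧ ρ v = Σ[ w ∈ Family ]
  ⟦ M ⟧ ρ (proj₂ w ↦ v) × (∀ i → ⟦ N ⟧ ρ (proj₂ w i))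

≼-▸ : {ρ ρ′ : Env n} {w : Family} → ρ ≼ ρ′ → (ρ ▸ w) ≼ (ρ′ ▸ w)
≼-▸ p zero    = λ i → i , ⊑-refl _
≼-▸ p (suc x) = p x

≼-refl : {ρ : Env n} → ρ ≼ ρ
≼-refl x i = i , ⊑-refl _

⟦⟧-mono : ∀ (M : Tm n) {ρ ρ′ u u′} → ρ ≼ ρ′ → u ⊑ u′ → ⟦ M ⟧ ρ u′ → ⟦ M ⟧ ρ′ u
⟦⟧-mono (var x) p q (i , r) =
  let j , s = p x i in j , ⊑-trans q (⊑-trans r s)
⟦⟧-mono U p univ refl = refl
⟦⟧-mono (Π A B) p pi (a , b) =
  (λ i → ⟦⟧-mono A p (⊑-refl _) (a i)) , (λ j → ⟦⟧-mono B (≼-▸ p) (⊑-refl _) (b j))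
⟦⟧-mono (ƛ A M) p (f ↦ q) (w₀ , g , a , b) =
  w₀ ,
  (λ i → let j , r = g i ; k , s = f j in k , ⊑-trans r s) ,
  (λ i → ⟦⟧-mono A p (⊑-refl _) (a i)) ,
  ⟦⟧-mono M (≼-▸ p) q b
⟦⟧-mono (M · N) p q (w , a , b) =
  w , ⟦⟧-mono M p ((λ i → i , ⊑-refl _) ↦ q) a , (λ i → ⟦⟧-mono N p (⊑-refl _) (b i))

⟦⟧-≼ : ∀ (M : Tm n) {ρ ρ′ u} → ρ ≼ ρ′ → ⟦ M ⟧ ρ u → ⟦ M ⟧ ρ′ u
⟦⟧-≼ M p = ⟦⟧-mono M p (⊑-refl _)

⟦⟧-⊑ : ∀ (M : Tm n) {ρ u u′} → u ⊑ u′ → ⟦ M ⟧ ρ u′ → ⟦ M ⟧ ρ u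
⟦⟧-⊑ M q = ⟦⟧-mono M ≼-refl q

-- Denotations under renaming and substitution

_⊢_∼_ : (Env n) → Sub Fin m n → Env m → Set₁
ρ ⊢ r ∼ ρ′ = ∀ x → ρ (lookup r x) ≡ ρ′ x

∼-▸ : {ρ : Env n} {r : Sub Fin m n} {ρ′ : Env m} {w : Family} →
      ρ ⊢ r ∼ ρ′ → (ρ ▸ w) ⊢ r VarSubst.↑ ∼ (ρ′ ▸ w)
∼-▸ p zero = refl
∼-▸ {ρ = ρ} {r} p (suc x) = trans (cong (ρ ▸ _) (lookup-map x suc r)) (p x)

⟦⟧-rename : ∀ (M : Tm m) {r : Sub Fin m n} {ρ ρ′ u} → ρ ⊢ r ∼ ρ′ →
            ⟦ M /Var r ⟧ ρ u → ⟦ M ⟧ ρ′ u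
⟦⟧-rename (var x) {u = u} p = subst (λ w → ∃ λ i → u ⊑ proj₂ w i) (p x)
⟦⟧-rename U p d = d
⟦⟧-rename (Π A B) {u = pi w v} p (a , b) =
  (λ i → ⟦⟧-rename A p (a i)) , (λ j → ⟦⟧-rename B (∼-▸ p) (b j))
⟦⟧-rename (ƛ A M) {u = w ↦ v} p (w₀ , g , a , b) =
  w₀ , g , (λ i → ⟦⟧-rename A p (a i)) , ⟦⟧-rename M (∼-▸ p) b
⟦⟧-rename (M · N) p (w , a , b) =
  w , ⟦⟧-rename M p a , (λ i → ⟦⟧-rename N p (b i))

⟦⟧-rename⁻ : ∀ (M : Tm m) {r : Sub Fin m n} {ρ ρ′ u} → ρ ⊢ r ∼ ρ′ →
             ⟦ M ⟧ ρ′ u → ⟦ M /Var r ⟧ ρ u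
⟦⟧-rename⁻ (var x) {u = u} p = subst (λ w → ∃ λ i → u ⊑ proj₂ w i) (sym (p x))
⟦⟧-rename⁻ U p d = d
⟦⟧-rename⁻ (Π A B) {u = pi w v} p (a , b) =
  (λ i → ⟦⟧-rename⁻ A p (a i)) , (λ j → ⟦⟧-rename⁻ B (∼-▸ p) (b j))
⟦⟧-rename⁻ (ƛ A M) {u = w ↦ v} p (w₀ , g , a , b) =
  w₀ , g , (λ i → ⟦⟧-rename⁻ A p (a i)) , ⟦⟧-rename⁻ M (∼-▸ p) b
⟦⟧-rename⁻ (M · N) p (w , a , b) =
  w , ⟦⟧-rename⁻ M p a , (λ i → ⟦⟧-rename⁻ N p (b i))

wk-∼ : {ρ : Env n} {w : Family} → (ρ ▸ w) ⊢ VarSubst.wk ∼ ρ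
wk-∼ {ρ = ρ} x = cong (ρ ▸ _) (VarLemmas.lookup-wk x)

⟦weaken⟧ : ∀ (M : Tm n) {ρ w u} → ⟦ weaken M ⟧ (ρ ▸ w) u → ⟦ M ⟧ ρ u
⟦weaken⟧ M = ⟦⟧-rename M wk-∼

⟦weaken⟧⁻ : ∀ (M : Tm n) {ρ w u} → ⟦ M ⟧ ρ u → ⟦ weaken M ⟧ (ρ ▸ w) u
⟦weaken⟧⁻ M = ⟦⟧-rename⁻ M wk-∼

_⊩_⦂_ : Env n → Sub Tm m n → Env m → Set₁
ρ ⊩ σ ⦂ ρ′ = ∀ x i → ⟦ lookup σ x ⟧ ρ (proj₂ (ρ′ x) i)

⊩-▸ : {ρ : Env n} {σ : Sub Tm m n} {ρ′ : Env m} {w : Family} →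
      ρ ⊩ σ ⦂ ρ′ → (ρ ▸ w) ⊩ σ ↑ ⦂ (ρ′ ▸ w)
⊩-▸ p zero i = i , ⊑-refl _
⊩-▸ {ρ = ρ} {σ} {ρ′} {w} p (suc x) i =
  subst (λ M → ⟦ M ⟧ (ρ ▸ w) (proj₂ (ρ′ x) i)) (sym (lookup-map x weaken σ))
    (⟦weaken⟧⁻ (lookup σ x) (p x i))

⟦/⟧⁻ : ∀ (M : Tm m) {σ : Sub Tm m n} {ρ ρ′ u} → ρ ⊩ σ ⦂ ρ′ →
       ⟦ M ⟧ ρ′ u → ⟦ M / σ ⟧ ρ u
⟦/⟧⁻ (var x) {σ} p (i , q) = ⟦⟧-⊑ (lookup σ x) q (p x i)
⟦/⟧⁻ U p d = d
⟦/⟧⁻ (Π A B) {u = pi w v} p (a , b) =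
  (λ i → ⟦/⟧⁻ A p (a i)) , (λ j → ⟦/⟧⁻ B (⊩-▸ p) (b j))
⟦/⟧⁻ (ƛ A M) {u = w ↦ v} p (w₀ , g , a , b) =
  w₀ , g , (λ i → ⟦/⟧⁻ A p (a i)) , ⟦/⟧⁻ M (⊩-▸ p) b
⟦/⟧⁻ (M · N) p (w , a , b) =
  w , ⟦/⟧⁻ M p a , (λ i → ⟦/⟧⁻ N p (b i))

-- Index sets of families are closed under dependent sums, so joins of
-- arbitrary families of environments exist.
⨆ : {K : Set} → (K → Env n) → Env n
⨆ {K = K} ρ x = (Σ[ k ∈ K ] proj₁ (ρ k x)) , λ (k , i) → proj₂ (ρ k x) i

≼-⨆ : {K : Set} (ρ : K → Env n) (k : K) → ρ k ≼ ⨆ ρ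
≼-⨆ ρ k x i = (k , i) , ⊑-refl _

⊩-⨆ : {K : Set} {ρ : Env n} {σ : Sub Tm m n} {ρ′ : K → Env m} →
      (∀ k → ρ ⊩ σ ⦂ ρ′ k) → ρ ⊩ σ ⦂ ⨆ ρ′
⊩-⨆ p x (k , i) = p k x i

-- A substitution instance is denoted in an environment that records the
-- information used at each occurrence of a variable.
Factors : Tm m → Sub Tm m n → Env n → Atom → Set₁
Factors {m} M σ ρ u = Σ[ ρ′ ∈ Env m ] ρ ⊩ σ ⦂ ρ′ × ⟦ M ⟧ ρ′ u

-- The atoms recorded at variable zero lie below those of `w`, so monotonicity replaces them by `w`;
-- at the other variables the weakening is undone.
strengthen : ∀ (M : Tm (suc m)) {σ : Sub Tm m n} {ρ w u} →
             Factors M (σ ↑) (ρ ▸ w) u →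
             Σ[ ρ′ ∈ Env m ] ρ ⊩ σ ⦂ ρ′ × ⟦ M ⟧ (ρ′ ▸ w) u
strengthen M {σ} {ρ} {w} {u} (ρ′ , p , d) =
  (λ x → ρ′ (suc x)) ,
  (λ x i → ⟦weaken⟧ (lookup σ x)
     (subst (λ N → ⟦ N ⟧ (ρ ▸ w) (proj₂ (ρ′ (suc x)) i)) (lookup-map x weaken σ)
       (p (suc x) i))) ,
  ⟦⟧-≼ M (λ { zero i → p zero i ; (suc x) i → i , ⊑-refl _ }) d

-- Each of the possibly infinitely many premises yields its own environment; `⨆` joins them, and
-- monotonicity transports every premise to the join.
⟦/⟧ : ∀ (M : Tm m) {σ : Sub Tm m n} {ρ u} → ⟦ M / σ ⟧ ρ u → Factors M σ ρ u
⟦/⟧ (var x) {σ} {ρ} {u} d = ρ′ , p , q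
  where
  ρ′ : Env _
  -- The index set is inhabited only at `x`, so `u` is recorded there and nothing elsewhere.
  ρ′ y = (y ≡ x) , λ _ → u
  p : ρ ⊩ σ ⦂ ρ′
  p y refl = d
  q : ∃ λ i → u ⊑ proj₂ (ρ′ x) i
  q = refl , ⊑-refl u
⟦/⟧ U d = (λ x → ⊥ , λ ()) , (λ _ ()) , d
⟦/⟧ (Π A B) {σ} {u = pi w v} (a , b) =
  let f = λ i → ⟦/⟧ A (a i)
      g = λ j → strengthen B (⟦/⟧ B (b j))
      ρ′ = [ (λ i → proj₁ (f i)) , (λ j → proj₁ (g j)) ]′
  in ⨆ ρ′ ,
     ⊩-⨆ {σ = σ} {ρ′} (λ { (inj₁ i) → proj₁ (proj₂ (f i)) ; (inj₂ j) → proj₁ (proj₂ (g j)) }) ,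
     (λ i → ⟦⟧-≼ A (≼-⨆ ρ′ (inj₁ i)) (proj₂ (proj₂ (f i)))) ,
     (λ j → ⟦⟧-≼ B (≼-▸ (≼-⨆ ρ′ (inj₂ j))) (proj₂ (proj₂ (g j))))
⟦/⟧ (ƛ A M) {σ} {u = w ↦ v} (w₀ , h , a , b) =
  let f = λ i → ⟦/⟧ A (a i)
      g = λ (_ : ⊤) → strengthen M (⟦/⟧ M b)
      ρ′ = [ (λ i → proj₁ (f i)) , (λ j → proj₁ (g j)) ]′
  in ⨆ ρ′ ,
     ⊩-⨆ {σ = σ} {ρ′} (λ { (inj₁ i) → proj₁ (proj₂ (f i)) ; (inj₂ j) → proj₁ (proj₂ (g j)) }) ,
     w₀ , h ,
     (λ i → ⟦⟧-≼ A (≼-⨆ ρ′ (inj₁ i)) (proj₂ (proj₂ (f i)))) ,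
     ⟦⟧-≼ M (≼-▸ (≼-⨆ ρ′ (inj₂ tt))) (proj₂ (proj₂ (g tt)))
⟦/⟧ (M · N) {σ} (w , a , b) =
  let f = λ i → ⟦/⟧ N (b i)
      g = λ (_ : ⊤) → ⟦/⟧ M a
      ρ′ = [ (λ i → proj₁ (f i)) , (λ j → proj₁ (g j)) ]′
  in ⨆ ρ′ ,
     ⊩-⨆ {σ = σ} {ρ′} (λ { (inj₁ i) → proj₁ (proj₂ (f i)) ; (inj₂ j) → proj₁ (proj₂ (g j)) }) ,
     w ,
     ⟦⟧-≼ M (≼-⨆ ρ′ (inj₂ tt)) (proj₂ (proj₂ (g tt))) ,
     (λ i → ⟦⟧-≼ N (≼-⨆ ρ′ (inj₁ i)) (proj₂ (proj₂ (f i))))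

⟦[]⟧⁻ : ∀ (M : Tm (suc n)) {N : Tm n} {ρ w u} → (∀ i → ⟦ N ⟧ ρ (proj₂ w i)) →
        ⟦ M ⟧ (ρ ▸ w) u → ⟦ M [ N ] ⟧ ρ u
⟦[]⟧⁻ M {N} {ρ} {w} p = ⟦/⟧⁻ M q
  where
  q : ρ ⊩ sub N ⦂ (ρ ▸ w)
  q zero    = p
  q (suc x) i = subst (λ L → ⟦ L ⟧ ρ (proj₂ (ρ x) i)) (sym (lookup-id x)) (i , ⊑-refl _)

-- The family is what the factoring environment records at variable zero; elsewhere `sub N` is the
-- identity, so the records lie below `ρ`.
⟦[]⟧ : ∀ (M : Tm (suc n)) {N : Tm n} {ρ u} → ⟦ M [ N ] ⟧ ρ u →
       Σ[ w ∈ Family ] (∀ i → ⟦ N ⟧ ρ (proj₂ w i)) × ⟦ M ⟧ (ρ ▸ w) u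
⟦[]⟧ M {N} {ρ} d with ⟦/⟧ M d
... | ρ′ , p , e = ρ′ zero , p zero , ⟦⟧-≼ M q e
  where
  q : ρ′ ≼ (ρ ▸ ρ′ zero)
  q zero    i = i , ⊑-refl _
  q (suc x) i = subst (λ L → ⟦ L ⟧ ρ (proj₂ (ρ′ (suc x)) i)) (lookup-id x) (p (suc x) i)

sub-/ : ∀ (M : Tm (suc m)) {N : Tm n} {σ : Sub Tm m n} → (M / σ ↑) [ N ] ≡ M / (N ∷ σ)
sub-/ M {N} {σ} = trans (sym (/-⊙ M)) (cong (λ τ → M / (N ∷ τ)) map-weaken-⊙-sub)

/-sub : ∀ (M : Tm (suc m)) {N : Tm m} {σ : Sub Tm m n} → M [ N ] / σ ≡ M / (N / σ ∷ σ)
/-sub M = trans (sub-commutes M) (sub-/ M)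

↝-deterministic : {M N N′ : Tm n} → M ↝ N → M ↝ N′ → N ≡ N′
↝-deterministic β        β        = refl
↝-deterministic (appˡ r) (appˡ s) = cong (_· _) (↝-deterministic r s)

-- A `Π` has no head step. The logical relation speaks of head reducts, and this identifies the
-- reducts that two of its instances give for one term.
Π-unique : {M A A′ : Tm n} {B B′ : Tm (suc n)} → M ↝* Π A B → M ↝* Π A′ B′ → Π A B ≡ Π A′ B′
Π-unique ε        ε        = refl
Π-unique (r ◅ rs) (s ◅ ss) with refl ← ↝-deterministic r s = Π-unique rs ss

_⊨_ : Env n → Ctx n → Set₁
ρ ⊨ Γ = ∀ {x A} → x ⦂ A ∈ Γ → ∀ i → ⟦ A ⟧ ρ (typeOf (proj₂ (ρ x) i))

⊨-▸ : {ρ : Env n} {Γ : Ctx n} {A : Tm n} {w : Family} → ρ ⊨ Γ →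
      (∀ i → ⟦ A ⟧ ρ (typeOf (proj₂ w i))) → (ρ ▸ w) ⊨ (Γ ▷ A)
⊨-▸ p q (here {A = A})     i = ⟦weaken⟧⁻ A (q i)
⊨-▸ p q (there {A = A} x∈) i = ⟦weaken⟧⁻ A (p x∈ i)

-- The logical relation

-- At a step atom, reversing or composing `R` moves between the codomains at two related arguments;
-- hence `symᴱ` and `transᴱ` assume a self-related type.
record PER {d} (T : Tm d → Tm d → Set) (R : Tm d → Tm d → Tm d → Set) : Set where
  field
    symᵀ   : ∀ {A B} → T A B → T B A
    transᵀ : ∀ {A B C} → T A B → T B C → T A C
    conv   : ∀ {A B M N} → T A B → R M N A → R M N B
    symᴱ   : ∀ {A M N} → T A A → R M N A → R N M A
    transᴱ : ∀ {A M N P} → T A A → R M N A → R N P A → R M P A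

  reflᵀ : ∀ {A B} → T A B → T A A
  reflᵀ t = transᵀ t (symᵀ t)

  reflᴱ : ∀ {A M N} → T A A → R M N A → R M M A
  reflᴱ t r = transᴱ t r (symᴱ t r)

PER-∀ : ∀ {d} {I : Set} {T : I → Tm d → Tm d → Set} {R : I → Tm d → Tm d → Tm d → Set} →
         (∀ i → PER (T i) (R i)) →
         PER (λ A B → ∀ i → T i A B) (λ M N A → ∀ i → R i M N A)
PER-∀ g = record
  { symᵀ   = λ t i → symᵀ (g i) (t i)
  ; transᵀ = λ t u i → transᵀ (g i) (t i) (u i)
  ; conv   = λ t r i → conv (g i) (t i) (r i)
  ; symᴱ   = λ t r i → symᴱ (g i) (t i) (r i)
  ; transᴱ = λ t r s i → transᴱ (g i) (t i) (r i) (s i)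
  }
  where open PER

module Logical {d} {Δ : Ctx d} (⊢Δ : ⊢ Δ) where

  infix 4 _⊢_≈_⦂_

  -- The parameters let one record serve for `Type` at steps and `Elem` at `pi` atoms.
  record ΠRel (T : Tm d → Tm d → Set) (R : Tm d → Tm d → Tm d → Set)
              (K : Tm d → Tm d → Set) (A A′ : Tm d) : Set where
    constructor mkΠRel
    field
      {A₁ A₁′} : Tm d
      {A₂ A₂′} : Tm (suc d)
      red  : A ↝* Π A₁ A₂
      red′ : A′ ↝* Π A₁′ A₂′
      dom≐ : Δ ⊢ A₁ ≐ A₁′ ⦂ U
      cod≐ : Δ ▷ A₁ ⊢ A₂ ≐ A₂′ ⦂ U
      dom  : T A₁ A₁′
      cod  : ∀ {N N′} → Δ ⊢ N ≐ N′ ⦂ A₁ → R N N′ A₁ → K (A₂ [ N ]) (A₂′ [ N′ ])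

  -- Type u relates types at the atom typeOf u; it is not defined as Elem (typeOf u)
  -- because the recursion would then not be structural.
  Type : Atom → Tm d → Tm d → Set
  Elem : Atom → Tm d → Tm d → Tm d → Set

  Type univ     A A′ = A ↝* U × A′ ↝* U
  Type (pi _ _) A A′ = A ↝* U × A′ ↝* U
  Type (w ↦ v)  A A′ =
    ΠRel (λ B B′ → ∀ i → Type (w i) B B′) (λ N N′ B → ∀ i → Elem (w i) N N′ B)
         (λ B B′ → ⊤ → Type v B B′) A A′

  Elem univ     M M′ _ = M ↝* U × M′ ↝* U
  Elem (pi w v) M M′ _ =
    ΠRel (λ B B′ → ∀ i → Type (w i) B B′) (λ N N′ B → ∀ i → Elem (w i) N N′ B)
         (λ B B′ → ∀ j → Type (v j) B B′) M M′
  Elem (w ↦ v)  M M′ A =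
    ∀ {A₁ A₂} → A ↝* Π A₁ A₂ → ∀ {N N′} → Δ ⊢ N ≐ N′ ⦂ A₁ →
    (∀ i → Elem (w i) N N′ A₁) → Elem v (M · N) (M′ · N′) (A₂ [ N ])

  module _ {T : Tm d → Tm d → Set} {R : Tm d → Tm d → Tm d → Set} {K : Tm d → Tm d → Set}
           (g : PER T R) where
    open PER g

    ΠRel-sym : (∀ {A B} → K A B → K B A) → ∀ {A A′} → ΠRel T R K A A′ → ΠRel T R K A′ A
    ΠRel-sym symᴷ (mkΠRel red red′ dom≐ cod≐ dom cod) =
      mkΠRel red′ red (eq-sym dom≐)
        (▷-conv-eq (eq-right dom≐) (eq-sym dom≐) (eq-sym cod≐))
        (symᵀ dom)
        (λ e n → symᴷ (cod (eq-sym (eq-conv e (eq-sym dom≐)))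
                           (symᴱ (reflᵀ dom) (conv (symᵀ dom) n))))

    -- The middle `Π` forms coincide. The first relation goes from `N` to `N′`, the second is used
    -- at `N′` and itself.
    ΠRel-trans : (∀ {A B C} → K A B → K B C → K A C) →
                 ∀ {A B C} → ΠRel T R K A B → ΠRel T R K B C → ΠRel T R K A C
    ΠRel-trans transᴷ (mkΠRel r r′ dom≐₁ cod≐₁ dom₁ cod₁) (mkΠRel s s′ dom≐₂ cod≐₂ dom₂ cod₂)
      with refl ← Π-unique r′ s =
      mkΠRel r s′ (eq-trans dom≐₁ dom≐₂)
        (eq-trans cod≐₁ (▷-conv-eq (eq-left dom≐₁) dom≐₁ cod≐₂))
        (transᵀ dom₁ dom₂)
        (λ e n → transᴷ (cod₁ e n)
          (cod₂ (eq-conv (eq-refl (eq-right e)) dom≐₁)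
                (conv dom₁ (reflᴱ (reflᵀ dom₁) (symᴱ (reflᵀ dom₁) n)))))

  per : ∀ u → PER (Type u) (Elem u)
  per univ = record
    { symᵀ   = λ (r , s) → s , r
    ; transᵀ = λ (r , _) (_ , s) → r , s
    ; conv   = λ _ r → r
    ; symᴱ   = λ _ (r , s) → s , r
    ; transᴱ = λ _ (r , _) (_ , s) → r , s
    }
  per (pi w v) = record
    { symᵀ   = λ (r , s) → s , r
    ; transᵀ = λ (r , _) (_ , s) → r , s
    ; conv   = λ _ r → r
    ; symᴱ   = λ _ → ΠRel-sym (PER-∀ (λ i → per (w i))) (symᵀ (PER-∀ (λ j → per (v j))))
    ; transᴱ = λ _ → ΠRel-trans (PER-∀ (λ i → per (w i))) (transᵀ (PER-∀ (λ j → per (v j))))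
    }
    where open PER
  per (w ↦ v) = record
    { symᵀ   = ΠRel-sym gw (symᵀ (PER-∀ (λ _ → per v)))
    ; transᵀ = ΠRel-trans gw (transᵀ (PER-∀ (λ _ → per v)))
    ; conv   = conv′
    ; symᴱ   = symᴱ′
    ; transᴱ = transᴱ′
    }
    where
    open PER
    gw : PER (λ B B′ → ∀ i → Type (w i) B B′) (λ N N′ B → ∀ i → Elem (w i) N N′ B)
    gw = PER-∀ (λ i → per (w i))

    conv′ : ∀ {A B M N} → Type (w ↦ v) A B → Elem (w ↦ v) M N A → Elem (w ↦ v) M N B
    conv′ (mkΠRel r r′ dom≐ cod≐ dom cod) f s e n with refl ← Π-unique r′ s =
      let e′ = eq-conv e (eq-sym dom≐)
          n′ = conv gw (symᵀ gw dom) n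
      in conv (per v) (cod (eq-refl (eq-left e′)) (reflᴱ gw (reflᵀ gw dom) n′) tt) (f r e′ n′)

    symᴱ′ : ∀ {A M N} → Type (w ↦ v) A A → Elem (w ↦ v) M N A → Elem (w ↦ v) N M A
    symᴱ′ (mkΠRel r r′ dom≐ cod≐ dom cod) f s e n
      with refl ← Π-unique r s | refl ← Π-unique r′ s =
      let e′ = eq-sym e
          n′ = symᴱ gw dom n
          -- Swapping the arguments yields the codomain at the second one; `t` carries the result
          -- back to the first.
          t  = cod e′ n′ tt
      in conv (per v) t (symᴱ (per v) (reflᵀ (per v) t) (f s e′ n′))

    transᴱ′ : ∀ {A M N P} → Type (w ↦ v) A A →
              Elem (w ↦ v) M N A → Elem (w ↦ v) N P A → Elem (w ↦ v) M P A
    transᴱ′ (mkΠRel r r′ dom≐ cod≐ dom cod) f g s e n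
      with refl ← Π-unique r s | refl ← Π-unique r′ s =
      let e′ = eq-sym e
          n′ = symᴱ gw dom n
          t  = cod e′ n′ tt
      in transᴱ (per v) (reflᵀ (per v) (symᵀ (per v) t)) (f s e n)
           (conv (per v) t (g s (eq-refl (eq-left e′)) (reflᴱ gw dom n′)))

  module G u = PER (per u)

  -- At a step, arguments move down from the demands of the smaller step to those of the larger, and
  -- results move down in turn; the codomain types come from the argument related to itself.
  Elem-⊑ : ∀ {u u′ A M M′} → u ⊑ u′ → Type u A A → Type u′ A A → Elem u′ M M′ A → Elem u M M′ A
  Elem-⊑ univ _ _ r = r
  Elem-⊑ pi   _ _ r = r
  Elem-⊑ (_↦_ {w = w} p q) (mkΠRel r r′ _ _ dom cod) (mkΠRel s s′ _ _ dom′ cod′) f t e n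
    with refl ← Π-unique r t | refl ← Π-unique r′ t | refl ← Π-unique s t | refl ← Π-unique s′ t =
    let n′ = λ i → let j , p′ = p i in Elem-⊑ p′ (dom′ i) (dom j) (n j)
        eᵣ = eq-refl (eq-left e)
        nᵣ = PER.reflᴱ (PER-∀ (λ i → per (w i))) dom n
    in Elem-⊑ q (cod eᵣ nᵣ tt)
         (cod′ eᵣ (λ i → let j , p′ = p i in Elem-⊑ p′ (dom′ i) (dom j) (nᵣ j)) tt)
         (f t e n′)

  ↝*-appˡ : {M M′ N : Tm d} → M ↝* M′ → M · N ↝* M′ · N
  ↝*-appˡ ε        = ε
  ↝*-appˡ (r ◅ rs) = appˡ r ◅ ↝*-appˡ rs

  -- At `univ` and `pi` the relation sees only head reducts, and at a step head reduction continues
  -- under application.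
  Elem-expand : ∀ u {M M₁ N N₁ A} → M ↝* M₁ → N ↝* N₁ → Elem u M₁ N₁ A → Elem u M N A
  Elem-expand univ     r s (p , q) = r ◅◅ p , s ◅◅ q
  Elem-expand (pi w v) r s (mkΠRel p q a b c d) = mkΠRel (r ◅◅ p) (s ◅◅ q) a b c d
  Elem-expand (w ↦ v)  r s f t e n = Elem-expand v (↝*-appˡ r) (↝*-appˡ s) (f t e n)

  -- Reversal moves each declaration from `A / σ` to `A / τ`; carrying `eq-ty` and `type` makes
  -- symmetry available before the fundamental theorem.
  record _⊢_≈_⦂_ {n} (ρ : Env n) (σ τ : Sub Tm n d) (Γ : Ctx n) : Set₁ where
    field
      typedˡ : Typed Δ σ Γ
      typedʳ : Typed Δ τ Γ
      eq     : Δ ⊢ σ ≗ τ ⦂ Γ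
      eq-ty  : ∀ {x A} → x ⦂ A ∈ Γ → Δ ⊢ A / σ ≐ A / τ ⦂ U
      type   : ∀ {x A} → x ⦂ A ∈ Γ → ∀ i → Type (proj₂ (ρ x) i) (A / σ) (A / τ)
      elem   : ∀ {x A} → x ⦂ A ∈ Γ → ∀ i →
               Elem (proj₂ (ρ x) i) (lookup σ x) (lookup τ x) (A / σ)
  open _⊢_≈_⦂_

  ≈-sym : {ρ : Env n} {σ τ : Sub Tm n d} {Γ : Ctx n} → ρ ⊢ σ ≈ τ ⦂ Γ → ρ ⊢ τ ≈ σ ⦂ Γ
  ≈-sym {ρ = ρ} s = record
    { typedˡ = typedʳ s
    ; typedʳ = typedˡ s
    ; eq     = λ x∈ → eq-conv (eq-sym (eq s x∈)) (eq-ty s x∈)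
    ; eq-ty  = λ x∈ → eq-sym (eq-ty s x∈)
    ; type   = λ x∈ i → G.symᵀ _ (type s x∈ i)
    ; elem   = λ {x} x∈ i → let u = proj₂ (ρ x) i ; t = type s x∈ i in
               G.conv u t (G.symᴱ u (G.reflᵀ u t) (elem s x∈ i))
    }

  ≈-refl : {ρ : Env n} {σ τ : Sub Tm n d} {Γ : Ctx n} → ρ ⊢ σ ≈ τ ⦂ Γ → ρ ⊢ σ ≈ σ ⦂ Γ
  ≈-refl {ρ = ρ} s = record
    { typedˡ = typedˡ s
    ; typedʳ = typedˡ s
    ; eq     = λ x∈ → eq-refl (typedˡ s x∈)
    ; eq-ty  = λ x∈ → eq-refl (eq-left (eq-ty s x∈))
    ; type   = λ x∈ i → G.reflᵀ _ (type s x∈ i)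
    ; elem   = λ {x} x∈ i → let u = proj₂ (ρ x) i in
               G.reflᴱ u (G.reflᵀ u (type s x∈ i)) (elem s x∈ i)
    }

  ≈-∷ : {ρ : Env n} {σ τ : Sub Tm n d} {Γ : Ctx n} {A : Tm n} {N N′ : Tm d} {w : Family} →
        ρ ⊢ σ ≈ τ ⦂ Γ → Γ ⊢ A ⦂ U → Δ ⊢ N ≐ N′ ⦂ A / σ →
        (∀ i → Type (proj₂ w i) (A / σ) (A / τ)) →
        (∀ i → Elem (proj₂ w i) N N′ (A / σ)) →
        (ρ ▸ w) ⊢ N ∷ σ ≈ N′ ∷ τ ⦂ (Γ ▷ A)
  ≈-∷ {ρ = ρ} {σ} {τ} {Γ} {A} {N} {N′} {w} s d e t r = record
    { typedˡ = ∷-Typed (typedˡ s) (eq-left e)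
    ; typedʳ = ∷-Typed (typedʳ s) (ty-conv (eq-right e) A≐)
    ; eq     = ≗-∷ (eq s) e
    ; eq-ty  = λ { (here {A = B})     → cast-eq (sym (weaken-∷ B)) (sym (weaken-∷ B)) refl A≐
                 ; (there {A = B} x∈) →
                     cast-eq (sym (weaken-∷ B)) (sym (weaken-∷ B)) refl (eq-ty s x∈) }
    ; type   = λ { (here {A = B})     i →
                     subst₂ (Type _) (sym (weaken-∷ B)) (sym (weaken-∷ B)) (t i)
                 ; (there {A = B} x∈) i →
                     subst₂ (Type _) (sym (weaken-∷ B)) (sym (weaken-∷ B)) (type s x∈ i) }
    ; elem   = λ { (here {A = B})     i → subst (Elem _ _ _) (sym (weaken-∷ B)) (r i)
                 ; (there {A = B} x∈) i →
                     subst (Elem _ _ _) (sym (weaken-∷ B)) (elem s x∈ i) }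
    }
    where
    A≐ : Δ ⊢ A / σ ≐ A / τ ⦂ U
    A≐ = functional ⊢Δ (typedˡ s) (eq s) d

  -- A denotation may contain atoms whose arguments are ill typed; M has type A
  -- when each of its atoms lies below one whose type belongs to the denotation of A.
  record Valid {n} (Γ : Ctx n) (M N A : Tm n) : Set₁ where
    field
      valid : ∀ {ρ u} → ρ ⊨ Γ → ⟦ M ⟧ ρ u → Σ[ u′ ∈ Atom ]
        u ⊑ u′ × ⟦ M ⟧ ρ u′ × ⟦ A ⟧ ρ (typeOf u′) ×
        (∀ {σ τ} → ρ ⊢ σ ≈ τ ⦂ Γ →
          Type u′ (A / σ) (A / τ) × Elem u′ (M / σ) (N / τ) (A / σ))
  open Valid

  -- Validity inspects the atoms of `M` only; agreement makes it symmetric and transitive. It is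
  -- restricted to environments fitting `Γ` because β and η rely on typed atoms.
  record Agree {n} (Γ : Ctx n) (M N : Tm n) : Set₁ where
    field
      to   : ∀ {ρ u} → ρ ⊨ Γ → ⟦ M ⟧ ρ u → ⟦ N ⟧ ρ u
      from : ∀ {ρ u} → ρ ⊨ Γ → ⟦ N ⟧ ρ u → ⟦ M ⟧ ρ u
  open Agree

  -- Case by case `Type u` is definitionally `Elem (typeOf u)`, the codomain of a step being indexed
  -- by `⊤` for this purpose. Only `typeOf u` itself lies above `typeOf u`, so validity returns that
  -- atom.
  valid-type : {Γ : Ctx n} {A A′ : Tm n} {ρ : Env n} → Valid Γ A A′ U → ρ ⊨ Γ →
               ∀ u → ⟦ A ⟧ ρ (typeOf u) → ∀ {σ τ} → ρ ⊢ σ ≈ τ ⦂ Γ → Type u (A / σ) (A′ / τ)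
  valid-type f p univ     a s with univ , univ , _ , _ , r ← valid f p a = proj₂ (r s)
  valid-type f p (pi _ _) a s with univ , univ , _ , _ , r ← valid f p a = proj₂ (r s)
  valid-type f p (w ↦ v)  a s with pi _ _ , pi , _ , _ , r ← valid f p a = proj₂ (r s)

  valid-elem : {Γ : Ctx n} {M N A : Tm n} {ρ : Env n} {σ τ : Sub Tm n d} {u : Atom} →
               Valid Γ M N A → ρ ⊨ Γ → ρ ⊢ σ ≈ τ ⦂ Γ → Type u (A / σ) (A / τ) → ⟦ M ⟧ ρ u →
               Elem u (M / σ) (N / τ) (A / σ)
  valid-elem {u = u} f p s t m with u′ , q , _ , _ , r ← valid f p m =
    Elem-⊑ q (G.reflᵀ u t) (G.reflᵀ u′ (proj₁ (r s))) (proj₂ (r s))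

  -- Both `M / σ` and `M / τ` are related to `N / τ`.
  valid-refl : {Γ : Ctx n} {M N A : Tm n} → Valid Γ M N A → Valid Γ M M A
  valid-refl f .valid p m with u , q , m′ , a , r ← valid f p m =
    u , q , m′ , a , λ s →
      let open G u
          t , e  = r s
          t′ , e′ = r (≈-refl (≈-sym s))
      in t , transᴱ (reflᵀ t) e (conv (symᵀ t) (symᴱ t′ e′))

  valid-sym : {Γ : Ctx n} {M N A : Tm n} → Agree Γ M N → Valid Γ M N A → Valid Γ N M A
  valid-sym g f .valid p m with u , q , m′ , a , r ← valid f p (from g p m) =
    u , q , to g p m′ , a , λ s →
      let open G u
          t , e = r (≈-sym s)
      in symᵀ t , conv t (symᴱ (reflᵀ t) e)

  valid-trans : {Γ : Ctx n} {M N P A : Tm n} → Agree Γ M N → Valid Γ M N A → Valid Γ N P A →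
                Valid Γ M P A
  valid-trans g f h .valid p m with u , q , m′ , a , r ← valid f p m =
    u , q , m′ , a , λ s →
      let open G u
          t , e = r (≈-refl s)
          t′ , _ = r s
      in t′ , transᴱ t e (valid-elem h p s t′ (to g p m′))

  valid-conv : {Γ : Ctx n} {M N A B : Tm n} → Valid Γ M N A → Agree Γ A B → Valid Γ A B U →
               Valid Γ M N B
  valid-conv f g h .valid p m with u , q , m′ , a , r ← valid f p m =
    u , q , m′ , to g p a , λ s →
      let open G u
          t = valid-type h p u a (≈-refl s)
      in transᵀ (symᵀ t) (valid-type h p u a s) , conv t (proj₂ (r s))

  -- Validity and agreement for each rule

  valid-var : {Γ : Ctx n} {x : Fin n} {A : Tm n} → x ⦂ A ∈ Γ → Valid Γ (var x) (var x) A
  valid-var {x = x} x∈ .valid {ρ} p (i , q) =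
    proj₂ (ρ x) i , q , (i , ⊑-refl _) , p x∈ i , λ s → type s x∈ i , elem s x∈ i

  valid-U : {Γ : Ctx n} → Valid Γ U U U
  valid-U .valid p refl = univ , univ , refl , refl , λ _ → (ε , ε) , (ε , ε)

  valid-Π : {Γ : Ctx n} {A A′ : Tm n} {B B′ : Tm (suc n)} →
            Γ ⊢ A ≐ A′ ⦂ U → Γ ▷ A ⊢ B ≐ B′ ⦂ U →
            Valid Γ A A′ U → Valid (Γ ▷ A) B B′ U → Valid Γ (Π A B) (Π A′ B′) U
  valid-Π {B = B} {B′} d e f g .valid {u = pi w v} p (a , b) =
    pi w v , pi , (a , b) , refl , λ {σ} {τ} s →
      let A = subst-ty ⊢Δ (typedˡ s) (eq-left d) in
      (ε , ε) ,
      mkΠRel ε ε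
        (eq-functional ⊢Δ (typedˡ s) (eq s) d)
        (eq-functional (extend ⊢Δ A) (lift-Typed A ⊢Δ (typedˡ s)) (≗-lift A ⊢Δ (eq s)) e)
        (λ i → valid-type f p (w i) (a i) s)
        (λ h n j → subst₂ (Type (v j)) (sym (sub-/ B)) (sym (sub-/ B′))
          (valid-type g (⊨-▸ p a) (v j) (b j)
            -- The bound variable is declared with `A` under both substitutions, so `A` is compared
            -- with itself here.
            (≈-∷ s (eq-left d) h (λ i → valid-type (valid-refl f) p (w i) (a i) s) n)))

  agree-Π : {Γ : Ctx n} {A A′ : Tm n} {B B′ : Tm (suc n)} →
            Agree Γ A A′ → Agree (Γ ▷ A) B B′ → Agree Γ (Π A B) (Π A′ B′)
  agree-Π f g .to {u = pi w v} p (a , b) =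
    (λ i → to f p (a i)) , λ j → to g (⊨-▸ p a) (b j)
  agree-Π f g .from {u = pi w v} p (a , b) =
    let a′ = λ i → from f p (a i) in a′ , λ j → from g (⊨-▸ p a′) (b j)

  -- The atom above `w ↦ v` is `w₀ ↦ v′`, with `w₀` the typed family from the denotation and `v′`
  -- the typed atom that the body supplies above `v`.
  valid-ƛ : {Γ : Ctx n} {A A′ : Tm n} {M M′ B : Tm (suc n)} →
            Γ ⊢ A ⦂ U → Γ ▷ A ⊢ B ⦂ U →
            Valid Γ A A U → Valid (Γ ▷ A) M M′ B → Valid Γ (ƛ A M) (ƛ A′ M′) (Π A B)
  valid-ƛ {M = M} {M′} {B} d e f g .valid {u = w ↦ v} p ((_ , w₀) , q , a , m)
    with v′ , q′ , m′ , b , r ← valid g (⊨-▸ p a) m =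
    w₀ ↦ v′ , q ↦ q′ , ((_ , w₀) , (λ i → i , ⊑-refl _) , a , m′) , (a , λ _ → b) , λ {σ} {τ} s →
      let A = subst-ty ⊢Δ (typedˡ s) d
          t = λ i → valid-type f p (w₀ i) (a i) s
      in
      mkΠRel ε ε
        (functional ⊢Δ (typedˡ s) (eq s) d)
        (functional (extend ⊢Δ A) (lift-Typed A ⊢Δ (typedˡ s)) (≗-lift A ⊢Δ (eq s)) e)
        t
        (λ h n _ → subst₂ (Type v′) (sym (sub-/ B)) (sym (sub-/ B)) (proj₁ (r (≈-∷ s d h t n)))) ,
      λ { ε {N} {N′} h n → Elem-expand v′ (β ◅ ε) (β ◅ ε)
            (subst₂ (λ X Y → Elem v′ X Y _) (sym (sub-/ M)) (sym (sub-/ M′))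
              (subst (Elem v′ _ _) (sym (sub-/ B)) (proj₂ (r (≈-∷ s d h t n))))) }

  agree-ƛ : {Γ : Ctx n} {A A′ : Tm n} {M M′ : Tm (suc n)} →
            Agree Γ A A′ → Agree (Γ ▷ A) M M′ → Agree Γ (ƛ A M) (ƛ A′ M′)
  agree-ƛ f g .to {u = w ↦ v} p (w₀ , q , a , m) =
    w₀ , q , (λ i → to f p (a i)) , to g (⊨-▸ p a) m
  agree-ƛ f g .from {u = w ↦ v} p (w₀ , q , a , m) =
    let a′ = λ i → from f p (a i) in w₀ , q , a′ , from g (⊨-▸ p a′) m

  valid-· : {Γ : Ctx n} {M M′ N N′ A : Tm n} {B : Tm (suc n)} →
            Γ ⊢ N ≐ N′ ⦂ A → Valid Γ M M′ (Π A B) → Valid Γ N N′ A →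
            Valid Γ (M · N) (M′ · N′) (B [ N ])
  valid-· {N = N} {B = B} d f g .valid p (w , m , n) with valid f p m
  ... | w₀ ↦ v , q ↦ q′ , m′ , (a , b) , r =
    let n₀ = λ i → let j , q″ = q i in ⟦⟧-⊑ N q″ (n j) in
    v , q′ , ((_ , w₀) , m′ , n₀) , ⟦[]⟧⁻ B n₀ (b tt) , λ s → case r s of λ
      { (mkΠRel ε ε _ _ dom cod , h) →
          -- The element relation compares `N` with `N′`, the type relation `N` with itself under
          -- the two substitutions.
          let e = λ i → valid-elem g p s (dom i) (n₀ i)
              eᵣ = λ i → valid-elem (valid-refl g) p s (dom i) (n₀ i)
          in
          subst₂ (Type v) (sym (sub-commutes B)) (sym (sub-commutes B))
            (cod (functional ⊢Δ (typedˡ s) (eq s) (eq-left d)) eᵣ tt) ,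
          subst (Elem v _ _) (sym (sub-commutes B))
            (h ε (eq-functional ⊢Δ (typedˡ s) (eq s) d) e) }

  agree-· : {Γ : Ctx n} {M M′ N N′ : Tm n} →
            Agree Γ M M′ → Agree Γ N N′ → Agree Γ (M · N) (M′ · N′)
  agree-· f g .to   p (w , m , n) = w , to f p m , λ i → to g p (n i)
  agree-· f g .from p (w , m , n) = w , from f p m , λ i → from g p (n i)

  valid-β : {Γ : Ctx n} {A N : Tm n} {M B : Tm (suc n)} →
            Γ ⊢ A ⦂ U → Γ ⊢ N ⦂ A → Valid Γ A A U → Valid (Γ ▷ A) M M B → Valid Γ N N A →
            Valid Γ (ƛ A M · N) (M [ N ]) (B [ N ])
  valid-β {N = N} {M} {B} d e f g h .valid p (w , ((_ , w₀) , q , a , m) , n)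
    with v , q′ , m′ , b , r ← valid g (⊨-▸ p a) m =
    let n₀ = λ i → let j , q″ = q i in ⟦⟧-⊑ N q″ (n j) in
    v , q′ , ((_ , w₀) , ((_ , w₀) , (λ i → i , ⊑-refl _) , a , m′) , n₀) , ⟦[]⟧⁻ B n₀ b , λ s →
      let t = λ i → valid-type f p (w₀ i) (a i) s
          T , E = r (≈-∷ s d (functional ⊢Δ (typedˡ s) (eq s) e) t
                      (λ i → valid-elem h p s (t i) (n₀ i)))
      in
      subst₂ (Type v) (sym (/-sub B)) (sym (/-sub B)) T ,
      -- Only the left side is a redex; the right side is already the instance of the body.
      Elem-expand v (β ◅ ε) ε
        (subst₂ (λ X Y → Elem v X Y _) (sym (sub-/ M)) (sym (/-sub M))
          (subst (Elem v _ _) (sym (/-sub B)) E))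

  -- For `from`, the atoms of `N` consumed by the body need not be typed by `A`, as the clause for
  -- `ƛ` demands; validity of `N` replaces each by a larger typed one.
  agree-β : {Γ : Ctx n} {A N : Tm n} {M : Tm (suc n)} →
            Valid Γ N N A → Agree Γ (ƛ A M · N) (M [ N ])
  agree-β {M = M} h .to p (w , (w₀ , q , a , m) , n) =
    ⟦[]⟧⁻ M (λ i → let j , q′ = q i in ⟦⟧-⊑ _ q′ (n j)) m
  agree-β {M = M} h .from p m with (I , w) , n , m′ ← ⟦[]⟧ M m =
    let w₀ = λ i → proj₁ (valid h p (n i)) in
    (I , w₀) ,
    ((I , w₀) , (λ i → i , ⊑-refl _) ,
      (λ i → let _ , _ , _ , a , _ = valid h p (n i) in a) ,
      ⟦⟧-≼ M (λ { zero i → i , proj₁ (proj₂ (valid h p (n i)))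
                ; (suc x) i → i , ⊑-refl _ }) m′) ,
    (λ i → let _ , _ , n′ , _ = valid h p (n i) in n′)

  -- A typed atom of a function is a step w ↦ v with w in its domain, and then
  -- v is an atom of the application to a fresh variable that denotes w.
  η-apply : ∀ (M : Tm n) {ρ I v} {w : I → Atom} →
            ⟦ M ⟧ ρ (w ↦ v) → ⟦ weaken M · var zero ⟧ (ρ ▸ (I , w)) v
  η-apply M m = _ , ⟦weaken⟧⁻ M m , λ i → i , ⊑-refl _

  η-abstract : ∀ (M : Tm n) {ρ I v} {w : I → Atom} →
               ⟦ weaken M · var zero ⟧ (ρ ▸ (I , w)) v → ⟦ M ⟧ ρ (w ↦ v)
  η-abstract M (w′ , m , n) = ⟦⟧-⊑ M (n ↦ ⊑-refl _) (⟦weaken⟧ M m)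

  -- Validity of `M` gives a step whose demands `w` are typed by `A`; validity of the application to
  -- a fresh variable denoting `w` then raises the result to a typed `v′`.
  valid-η : {Γ : Ctx n} {M N A : Tm n} {B : Tm (suc n)} →
            Γ ⊢ A ⦂ U → Valid Γ M M (Π A B) →
            Valid (Γ ▷ A) (weaken M · var zero) (weaken N · var zero) B →
            Valid Γ M N (Π A B)
  valid-η {M = M} {N} {A} {B} d f g .valid p m with valid f p m
  ... | w ↦ v , q , m₁ , (a , b) , r with valid g (⊨-▸ p a) (η-apply M m₁)
  ... | v′ , q′ , m₂ , b′ , r′ =
    w ↦ v′ , ⊑-trans q ((λ i → i , ⊑-refl _) ↦ q′) , η-abstract M m₂ , (a , λ _ → b′) , λ s →
      case r s of λ
        { (mkΠRel ε ε dom≐ cod≐ dom _ , _) →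
            mkΠRel ε ε dom≐ cod≐ dom
              (λ h n _ → subst₂ (Type v′) (sym (sub-/ B)) (sym (sub-/ B))
                (proj₁ (r′ (≈-∷ s d h dom n)))) ,
            λ { ε {X} {Y} h n →
              subst₂ (λ F G → Elem v′ (F · X) (G · Y) _) (weaken-∷ M) (weaken-∷ N)
                (subst (Elem v′ _ _) (sym (sub-/ B)) (proj₂ (r′ (≈-∷ s d h dom n)))) } }

  η-⟦⟧ : {Γ : Ctx n} {M N A : Tm n} {B : Tm (suc n)} {ρ : Env n} {u : Atom} →
         Valid Γ M M (Π A B) →
         Agree (Γ ▷ A) (weaken M · var zero) (weaken N · var zero) →
         ρ ⊨ Γ → ⟦ M ⟧ ρ u → ⟦ N ⟧ ρ u
  η-⟦⟧ {M = M} {N} f g p m with valid f p m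
  ... | w ↦ v , q , m₁ , (a , b) , _ =
    ⟦⟧-⊑ N q (η-abstract N (to g (⊨-▸ p a) (η-apply M m₁)))

  agree-sym : {Γ : Ctx n} {M N : Tm n} → Agree Γ M N → Agree Γ N M
  agree-sym g .to   = from g
  agree-sym g .from = to g

  agree-η : {Γ : Ctx n} {M N A : Tm n} {B : Tm (suc n)} →
            Valid Γ M M (Π A B) → Valid Γ N N (Π A B) →
            Agree (Γ ▷ A) (weaken M · var zero) (weaken N · var zero) → Agree Γ M N
  agree-η f g h .to   = η-⟦⟧ f h
  agree-η f g h .from = η-⟦⟧ g (agree-sym h)

  -- Agreement is proved alongside validity because `ty-conv` must carry the type of an atom from
  -- one denotation to the other.
  fundamental    : {Γ : Ctx n} {M A : Tm n} → Γ ⊢ M ⦂ A → Valid Γ M M A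
  fundamental-eq : {Γ : Ctx n} {M N A : Tm n} → Γ ⊢ M ≐ N ⦂ A → Valid Γ M N A × Agree Γ M N

  fundamental (ty-var _ x∈) = valid-var x∈
  fundamental (ty-univ _)   = valid-U
  fundamental (ty-pi A B)   = valid-Π (eq-refl A) (eq-refl B) (fundamental A) (fundamental B)
  fundamental (ty-lam A d) =
    valid-ƛ A (ty-valid d) (fundamental A) (fundamental d)
  fundamental (ty-app d e) =
    valid-· (eq-refl e) (fundamental d) (fundamental e)
  fundamental (ty-conv d e) =
    let f , g = fundamental-eq e in valid-conv (fundamental d) g f

  fundamental-eq (eq-refl d) =
    fundamental d , record { to = λ _ m → m ; from = λ _ m → m }
  fundamental-eq (eq-sym d) =
    let f , g = fundamental-eq d in valid-sym g f , agree-sym g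
  fundamental-eq (eq-trans d e) =
    let f , g = fundamental-eq d ; f′ , g′ = fundamental-eq e in
    valid-trans g f f′ ,
    record { to = λ p m → to g′ p (to g p m) ; from = λ p m → from g p (from g′ p m) }
  fundamental-eq (eq-conv d e) =
    let f , g = fundamental-eq d ; f′ , g′ = fundamental-eq e in
    valid-conv f g′ f′ , g
  fundamental-eq (eq-pi d e) =
    let f , g = fundamental-eq d ; f′ , g′ = fundamental-eq e in
    valid-Π d e f f′ , agree-Π g g′
  fundamental-eq (eq-lam d e) =
    let f , g = fundamental-eq d ; f′ , g′ = fundamental-eq e in
    valid-ƛ (eq-left d) (eq-valid e) (valid-refl f) f′ ,
    agree-ƛ g g′
  fundamental-eq (eq-app d e) =
    let f , g = fundamental-eq d ; f′ , g′ = fundamental-eq e in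
    valid-· e f f′ , agree-· g g′
  fundamental-eq (eq-β d e h) =
    valid-β d h (fundamental d) (fundamental e) (fundamental h) ,
    agree-β (fundamental h)
  fundamental-eq (eq-η d e h) =
    let f , g = fundamental-eq h in
    valid-η (proj₁ (Π-inversion (ty-valid d))) (fundamental d) f ,
    agree-η (fundamental d) (fundamental e) g

-- Injectivity of Π and preservation

∅ᶠ : ⊥ → Atom
∅ᶠ ()

∅ᵉ : Env n
∅ᵉ _ = ⊥ , ∅ᶠ

-- With no atoms at any variable, the semantic conditions are vacuous, so open terms are covered
-- without interpreting free variables.
id-≈ : {Γ : Ctx n} (Γ✓ : ⊢ Γ) → Logical._⊢_≈_⦂_ Γ✓ ∅ᵉ id id Γ
id-≈ Γ✓ = record
  { typedˡ = id-Typed Γ✓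
  ; typedʳ = id-Typed Γ✓
  ; eq     = λ x∈ → eq-refl (id-Typed Γ✓ x∈)
  ; eq-ty  = λ x∈ → eq-refl (ty-valid (id-Typed Γ✓ x∈))
  ; type   = λ _ ()
  ; elem   = λ _ ()
  }

Π-injective : {Γ : Ctx n} {A A′ : Tm n} {B B′ : Tm (suc n)} → Γ ⊢ Π A B ≐ Π A′ B′ ⦂ U →
              Γ ⊢ A ≐ A′ ⦂ U × Γ ▷ A ⊢ B ≐ B′ ⦂ U
Π-injective {Γ = Γ} {A} {A′} {B} {B′} d =
  case subst₂ (λ M N → Elem (pi ∅ᶠ ∅ᶠ) M N U) (id-vanishes (Π A B)) (id-vanishes (Π A′ B′)) r of λ
    { (mkΠRel ε ε dom≐ cod≐ _ _) → dom≐ , cod≐ }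
  where
  Γ✓ : ⊢ Γ
  Γ✓ = ty-ctx (eq-left d)
  open Logical Γ✓
  r : Elem (pi ∅ᶠ ∅ᶠ) (Π A B / id) (Π A′ B′ / id) U
  -- The empty families make membership in the denotation vacuous, and no other atom lies above a
  -- `pi` atom, so validity returns this one.
  r with pi _ _ , pi , _ , _ , r′ ←
         Valid.valid (proj₁ (fundamental-eq d)) {∅ᵉ} {pi ∅ᶠ ∅ᶠ} (λ _ ()) ((λ ()) , λ ()) =
    proj₂ (r′ (id-≈ Γ✓))

ƛ-inversion : {Γ : Ctx n} {A C : Tm n} {M : Tm (suc n)} → Γ ⊢ ƛ A M ⦂ C →
              ∃ λ B → Γ ⊢ A ⦂ U × Γ ▷ A ⊢ M ⦂ B × Γ ⊢ Π A B ≐ C ⦂ U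
ƛ-inversion (ty-lam A M) = _ , A , M , eq-refl (ty-pi A (ty-valid M))
ƛ-inversion (ty-conv d e) with B , A , M , e′ ← ƛ-inversion d = B , A , M , eq-trans e′ e

↝-preserves : {Γ : Ctx n} {M M′ A : Tm n} → Γ ⊢ M ⦂ A → M ↝ M′ → Γ ⊢ M′ ⦂ A
↝-preserves (ty-conv d e) r        = ty-conv (↝-preserves d r) e
↝-preserves (ty-app d e)  (appˡ r) = ty-app (↝-preserves d r) e
↝-preserves (ty-app d e)  β
  with _ , _ , M , Π≐ ← ƛ-inversion d
  with A≐ , B≐ ← Π-injective Π≐ =
  -- The argument is converted to the annotated domain, and the type of the contractum back to the
  -- expected codomain.
  let N = ty-conv e (eq-sym A≐) in ty-conv ([]-ty M N) ([]-eq B≐ N)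

theorem2p38 : {n : ℕ} {Γ : Ctx n} {M M′ A : Tm n} →
    Γ ⊢ M ⦂ A → M ↝* M′ → Γ ⊢ M′ ⦂ A
theorem2p38 d ε        = d
theorem2p38 d (r ◅ rs) = theorem2p38 (↝-preserves d r) rs
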